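{- If $\langle M,\in^M\rangle$ is a model of Gödel–Bernays set theory GBC (in its one-sorted formalization, in which every object is a class), then the inclusion structure $\langle M,\subseteq^M\rangle$ on all classes of $M$ is an $\omega$-saturated infinite atomic Boolean algebra.
   Context: In the one-sorted formalization of GBC every object is a class, and sets are the classes that are elements of some class. For $\langle M,\in^M\rangle$, $a\subseteq^M b$ iff for all $c\in M$, $c\in^M a\Rightarrow c\in^M b$. An atomic Boolean algebra is one in which every nonzero element lies above a minimal nonzero element (atom). $\omega$-saturated means every 1-type over finitely many parameters finitely satisfiable in the structure is realized. -}

module Defs where

open import Level using (0ℓ)
open import Data.Nat using (ℕ; suc)
open import Data.Fin using (Fin; zero; suc)
open import Data.Vec.Functional using (Vector; _∷_)
open import Data.List using (List)
open import Data.List.Relation.Unary.All using (All)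
open import Data.Product using (Σ; _×_; _,_)
open import Data.Sum using (_⊎_)
open import Data.Empty using (⊥)
open import Relation.Nullary using (¬_)
open import Relation.Binary.PropositionalEquality using (_≡_)
open import Relation.Binary.Lattice.Structures using (IsBooleanAlgebra)

infix 2 _iff_
_iff_ : Set → Set → Set
A iff B = (A → B) × (B → A)

-- First-order formulas in a language with equality and ONE binary
-- relation symbol, with de Bruijn variables: Formula n has the free
-- variables x₀ … x_{n-1}; a quantifier binds variable zero.

data Formula : ℕ → Set where
  rel  : ∀ {n} → Fin n → Fin n → Formula n
  eq   : ∀ {n} → Fin n → Fin n → Formula n
  fls  : ∀ {n} → Formula n
  _∧f_ : ∀ {n} → Formula n → Formula n → Formula n
  _∨f_ : ∀ {n} → Formula n → Formula n → Formula n
  _⇒f_ : ∀ {n} → Formula n → Formula n → Formula n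
  all  : ∀ {n} → Formula (suc n) → Formula n
  ex   : ∀ {n} → Formula (suc n) → Formula n

Sat : {A : Set} → (A → A → Set) → ∀ {n} → Vector A n → Formula n → Set
Sat R ρ (rel i j) = R (ρ i) (ρ j)
Sat R ρ (eq i j)  = ρ i ≡ ρ j
Sat R ρ fls       = ⊥
Sat R ρ (φ ∧f ψ)  = Sat R ρ φ × Sat R ρ ψ
Sat R ρ (φ ∨f ψ)  = Sat R ρ φ ⊎ Sat R ρ ψ
Sat R ρ (φ ⇒f ψ)  = Sat R ρ φ → Sat R ρ ψ
Sat R ρ (all φ)   = ∀ x → Sat R (x ∷ ρ) φ
Sat R ρ (ex φ)    = Σ _ λ x → Sat R (x ∷ ρ) φ

-- ∈-structures (one-sorted: every object is a class)

record ∈-Structure : Set₁ where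
  field
    Carrier : Set
    _∈_     : Carrier → Carrier → Set

module GBC (M : ∈-Structure) where
  open ∈-Structure M

  IsSet : Carrier → Set
  IsSet x = Σ Carrier λ y → x ∈ y

  _⊆_ : Carrier → Carrier → Set
  a ⊆ b = ∀ c → c ∈ a → c ∈ b

  SetF : ∀ {n} → Fin n → Formula n
  SetF i = ex (rel (suc i) zero)

  relSet : ∀ {n} → Formula n → Formula n
  relSet (rel i j) = rel i j
  relSet (eq i j)  = eq i j
  relSet fls       = fls
  relSet (φ ∧f ψ)  = relSet φ ∧f relSet ψ
  relSet (φ ∨f ψ)  = relSet φ ∨f relSet ψ
  relSet (φ ⇒f ψ)  = relSet φ ⇒f relSet ψ
  relSet (all φ)   = all (SetF zero ⇒f relSet φ)
  relSet (ex φ)    = ex (SetF zero ∧f relSet φ)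

  IsUPair : Carrier → Carrier → Carrier → Set
  IsUPair z a b = ∀ t → t ∈ z iff (t ≡ a ⊎ t ≡ b)

  IsOrdPair : Carrier → Carrier → Carrier → Set
  IsOrdPair p a b = ∀ z → z ∈ p iff (IsUPair z a a ⊎ IsUPair z a b)

  IsFunction : Carrier → Set
  IsFunction F =
    (∀ p → p ∈ F → Σ Carrier λ a → Σ Carrier λ b → IsOrdPair p a b) ×
    (∀ p q a b b′ → p ∈ F → q ∈ F → IsOrdPair p a b → IsOrdPair q a b′
       → b ≡ b′)

  Extensionality : Set
  Extensionality = ∀ a b → (∀ c → c ∈ a iff c ∈ b) → a ≡ b

  Pairing : Set
  Pairing = ∀ x y → IsSet x → IsSet y →
    Σ Carrier λ z → IsSet z × IsUPair z x y

  Union : Set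
  Union = ∀ x → IsSet x →
    Σ Carrier λ u → IsSet u ×
      (∀ w → w ∈ u iff (Σ Carrier λ v → v ∈ x × w ∈ v))

  PowerSet : Set
  PowerSet = ∀ x → IsSet x →
    Σ Carrier λ p → IsSet p × (∀ w → w ∈ p iff (IsSet w × w ⊆ x))

  Infinity : Set
  Infinity = Σ Carrier λ x → IsSet x ×
    (Σ Carrier λ e → e ∈ x × (∀ v → ¬ v ∈ e)) ×
    (∀ y → y ∈ x → Σ Carrier λ s → s ∈ x × (∀ w → w ∈ s iff (w ∈ y ⊎ w ≡ y)))

  Separation : Set
  Separation = ∀ x A → IsSet x →
    Σ Carrier λ y → IsSet y × (∀ w → w ∈ y iff (w ∈ x × w ∈ A))

  Replacement : Set
  Replacement = ∀ F x → IsFunction F → IsSet x →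
    Σ Carrier λ y → IsSet y ×
      (∀ w → w ∈ y iff (Σ Carrier λ v → Σ Carrier λ p →
                          v ∈ x × p ∈ F × IsOrdPair p v w))

  Foundation : Set
  Foundation = ∀ A → (Σ Carrier λ w → w ∈ A) →
    Σ Carrier λ w → w ∈ A × (∀ t → t ∈ w → ¬ t ∈ A)

  GlobalChoice : Set
  GlobalChoice = Σ Carrier λ C → IsFunction C ×
    (∀ x → IsSet x → (Σ Carrier λ w → w ∈ x) →
      Σ Carrier λ y → Σ Carrier λ p → y ∈ x × p ∈ C × IsOrdPair p x y)

  Comprehension : Set
  Comprehension = ∀ n (φ : Formula (suc n)) (params : Vector Carrier n) →
    Σ Carrier λ A → ∀ w →
      w ∈ A iff (IsSet w × Sat _∈_ (w ∷ params) (relSet φ))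

  record IsModel : Set where
    field
      extensionality : Extensionality
      pairing        : Pairing
      union          : Union
      powerSet       : PowerSet
      infinity       : Infinity
      separation     : Separation
      replacement    : Replacement
      foundation     : Foundation
      globalChoice   : GlobalChoice
      comprehension  : Comprehension

module _ {A : Set} (_≤_ : A → A → Set) where

  record IsAtomicBooleanAlgebra : Set where
    field
      _∨_  : A → A → A
      _∧_  : A → A → A
      ¬′_  : A → A
      top  : A
      bot  : A
      isBooleanAlgebra : IsBooleanAlgebra _≡_ _≤_ _∨_ _∧_ ¬′_ top bot

    IsAtom : A → Set
    IsAtom a = ¬ (a ≡ bot) × (∀ b → b ≤ a → b ≡ bot ⊎ b ≡ a)

    field
      atomic : ∀ x → ¬ (x ≡ bot) → Σ A λ a → IsAtom a × a ≤ x

  -- ω-saturation: every 1-type over finitely many parameters that is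
  -- finitely satisfiable is realized.  A type in variable x₀ over
  -- parameters a : Fin n → A is a set p of formulas with free variables
  -- x₀ (the realized variable) and x₁ … xₙ (the parameters).
  FinitelySatisfiable : ∀ {n} → Vector A n → (Formula (suc n) → Set) → Set
  FinitelySatisfiable {n} a p = ∀ (l : List (Formula (suc n))) → All p l →
      Σ A λ m → All (Sat _≤_ (m ∷ a)) l

  Realized : ∀ {n} → Vector A n → (Formula (suc n) → Set) → Set
  Realized a p = Σ A λ m → ∀ φ → p φ → Sat _≤_ (m ∷ a) φ

  ωSaturated : Set₁
  ωSaturated = ∀ n (a : Vector A n) (p : Formula (suc n) → Set) →
    FinitelySatisfiable a p → Realized a p

Infinite : Set → Set
Infinite A = ¬ (Σ ℕ λ n → Σ (Fin n → A) λ f → ∀ x → Σ (Fin n) λ i → f i ≡ x)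

{-# OPTIONS --safe #-}
module Submission where

-- The first-order type of x over a₁ … aₙ in an atomic Boolean algebra of classes is governed
-- by the sizes (a finite number or ∞, counted in the metatheory) of the 2ⁿ⁺¹ cells of
-- x, a₁ … aₙ: in the Ehrenfeucht–Fraïssé game each quantifier at most doubles the threshold
-- at which sizes must be compared.  A finitely satisfiable type can be extended by a size for
-- every cell, and these sizes are realized cell by cell.  The only case that uses GBC in an
-- essential way is a cell that x must cut into two infinite parts, M possibly being ω-nonstandard.
--
-- To cut an infinite class A, iterate a definable growth step s ↦ s ∪ κ(s), where κ(s) is a
-- nonempty finite subset of A ∖ s, and collect what is added at even stages; the odd
-- stages are the rest.  If A has an infinite subset that is a set, κ(s) comes from the global
-- choice function.  Otherwise the finite subclasses of A are exactly its subsets, and global choice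
-- applied to pairs makes A a tournament.  Unless it already cuts A, an infinite subclass
-- of A has all out-degrees finite, or all in-degrees finite, and κ(s) is
-- the set of kings of A ∖ s, the points reachable from every point in two steps.

open import Defs
open import Level using (0ℓ)
open import Axiom.ExcludedMiddle using (ExcludedMiddle)
open import Data.Bool.Base using (Bool; true; false)
open import Data.Empty using (⊥; ⊥-elim)
open import Data.Fin.Base using (Fin; zero; suc)
open import Data.List.Base using (List; []; _∷_; _++_)
open import Data.List.Relation.Unary.All using (All; []; _∷_)
open import Data.List.Relation.Unary.All.Properties using (++⁺; ++⁻ˡ; ++⁻ʳ)
open import Data.Maybe.Base using (Maybe; just; nothing)
open import Data.Nat.Base using (ℕ; zero; suc; _+_; _⊔_; _≤_; _<_; z≤n; s≤s)
open import Data.Nat.Properties using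
  ( ≤-refl; ≤-trans; ≤-total; <⇒≤; +-suc; +-mono-≤; n≤1+n; m≤m+n; m<n⇒m<1+n
  ; m≤n⇒m<n∨m≡n; m≤n⇒m≤1+n; m≤m⊔n; m≤n⊔m )
open import Data.Product.Base using (Σ; _×_; _,_; proj₁; proj₂; map₂)
open import Data.Sum.Base as Sum using (_⊎_; inj₁; inj₂; [_,_]′)
open import Data.Unit.Base using (⊤; tt)
open import Data.Vec.Base using (Vec; []; _∷_)
open import Data.Vec.Functional using (Vector) renaming (_∷_ to _◂_; [] to ⟨⟩)
open import Function.Base using (id; _∘_; flip)
open import Relation.Binary.PropositionalEquality
  using (_≡_; refl; sym; trans; subst; isEquivalence)
open import Relation.Nullary using (¬_; yes; no; contradiction)

-- Counting in the metatheory

module Counting (em : ExcludedMiddle 0ℓ) {A : Set} where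

  dne : {P : Set} → ¬ ¬ P → P
  dne {P} h with em {P}
  ... | yes p = p
  ... | no ¬p = contradiction ¬p h

  ¬∀⇒∃¬ : {B : Set} {P : B → Set} → ¬ (∀ x → P x) → Σ B λ x → ¬ P x
  ¬∀⇒∃¬ h = dne λ g → h λ x → dne λ np → g (x , np)

  -- `k` is a number of the metatheory: in an ω-nonstandard model, a set that the model takes to be
  -- finite may be `Inf`.
  AtLeast : ℕ → (A → Set) → Set
  AtLeast zero    P = ⊤
  AtLeast (suc k) P = Σ A λ w → P w × AtLeast k (λ v → P v × ¬ v ≡ w)

  Exact : ℕ → (A → Set) → Set
  Exact k P = AtLeast k P × ¬ AtLeast (suc k) P

  Inf Finite : (A → Set) → Set
  Inf  P = ∀ k → AtLeast k P
  Finite P = Σ ℕ λ k → ¬ AtLeast k P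

  AtLeast-mono : ∀ {P Q : A → Set} k → (∀ w → P w → Q w) → AtLeast k P → AtLeast k Q
  AtLeast-mono zero    f _            = tt
  AtLeast-mono (suc k) f (w , p , ps) =
    w , f w p , AtLeast-mono k (λ v (q , ne) → f v q , ne) ps

  AtLeast-down : ∀ {P : A → Set} {j k} → j ≤ k → AtLeast k P → AtLeast j P
  AtLeast-down z≤n       _            = tt
  AtLeast-down (s≤s j≤k) (w , p , ps) = w , p , AtLeast-down j≤k ps

  Exact-cong : ∀ {P Q : A → Set} {k} → (∀ w → P w → Q w) → (∀ w → Q w → P w) →
    Exact k P → Exact k Q
  Exact-cong f g (h , h′) = AtLeast-mono _ f h , h′ ∘ AtLeast-mono _ g

  -- Each counted point is charged to `P` or to `Q`. The bound `suc j` is the one that `Exact j P`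
  -- forbids.
  AtLeast-pigeonhole : ∀ {R P Q : A → Set} j k → (∀ w → R w → P w ⊎ Q w) →
    AtLeast (j + k) R → AtLeast (suc j) P ⊎ AtLeast k Q
  AtLeast-pigeonhole j zero cov h = inj₂ tt
  AtLeast-pigeonhole zero (suc k) cov (w , r , rs) =
    [ (λ p → inj₁ (w , p , tt))
    , (λ q → Sum.map₂ (λ qs → w , q , qs)
               (AtLeast-pigeonhole zero k (λ v (rv , ne) → Sum.map₂ (_, ne) (cov v rv)) rs))
    ]′ (cov w r)
  AtLeast-pigeonhole {R} (suc j) (suc k) cov (w , r , rs) =
    [ (λ p → Sum.map₁ (λ ps → w , p , ps)
               (AtLeast-pigeonhole j (suc k) (λ v (rv , ne) → Sum.map₁ (_, ne) (cov v rv)) rs))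
    , (λ q → Sum.map₂ (λ qs → w , q , qs)
               (AtLeast-pigeonhole (suc j) k (λ v (rv , ne) → Sum.map₂ (_, ne) (cov v rv))
                 (subst (λ i → AtLeast i (λ v → R v × ¬ v ≡ w)) (+-suc j k) rs)))
    ]′ (cov w r)

  AtLeast-+ : ∀ {R P Q : A → Set} j k → (∀ w → P w → R w) → (∀ w → Q w → R w) →
    (∀ w → P w → ¬ Q w) → AtLeast j P → AtLeast k Q → AtLeast (j + k) R
  AtLeast-+ zero    k f g d _            qs = AtLeast-mono k g qs
  AtLeast-+ (suc j) k f g d (w , p , ps) qs =
    w , f w p , AtLeast-+ j k (λ v (pv , ne) → f v pv , ne)
                  (λ v q → g v q , λ { refl → d w p q }) (λ v (pv , _) → d v pv) ps qs

  AtLeast-remove : ∀ {P : A → Set} k u →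
    AtLeast (suc k) P → AtLeast k (λ v → P v × ¬ v ≡ u)
  AtLeast-remove {P} k u h with AtLeast-pigeonhole {P = _≡ u} 1 k cov h
    where
    cov : ∀ w → P w → w ≡ u ⊎ (P w × ¬ w ≡ u)
    cov w p with em {w ≡ u}
    ... | yes e = inj₁ e
    ... | no ne = inj₂ (p , ne)
  ... | inj₁ (_ , e , _ , (e′ , ne) , _) = contradiction (trans e′ (sym e)) ne
  ... | inj₂ h′ = h′

  Exact-insert : ∀ {P Q : A → Set} {k u} → (∀ w → P w → Q w) → (∀ w → Q w → P w ⊎ w ≡ u) →
    Q u → ¬ P u → Exact k P → Exact (suc k) Q
  Exact-insert {k = k} {u} f g qu ¬pu (h , h′) =
    (u , qu , AtLeast-mono k (λ v p → f v p , λ { refl → ¬pu p }) h) ,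
    λ h″ → h′ (AtLeast-mono (suc k) (λ v (q , ne) → [ id , (λ e → contradiction e ne) ]′ (g v q))
                (AtLeast-remove (suc k) u h″))

  size : ∀ N (P : A → Set) → AtLeast N P ⊎ Σ ℕ λ j → j < N × Exact j P
  size zero    P = inj₁ tt
  size (suc N) P with size N P
  ... | inj₂ (j , j<N , e) = inj₂ (j , m<n⇒m<1+n j<N , e)
  ... | inj₁ h with em {AtLeast (suc N) P}
  ...   | yes h′ = inj₁ h′
  ...   | no ¬h  = inj₂ (N , ≤-refl , h , ¬h)

  ¬Inf⇒Fin : ∀ {P : A → Set} → ¬ Inf P → Finite P
  ¬Inf⇒Fin = ¬∀⇒∃¬

  Fin-mono : ∀ {P Q : A → Set} → (∀ w → Q w → P w) → Finite P → Finite Q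
  Fin-mono f (k , h) = k , h ∘ AtLeast-mono k f

  Inf-mono : ∀ {P Q : A → Set} → (∀ w → P w → Q w) → Inf P → Inf Q
  Inf-mono f h k = AtLeast-mono k f (h k)

  Fin-∪ : ∀ {P Q R : A → Set} → (∀ w → R w → P w ⊎ Q w) → Finite P → Finite Q → Finite R
  Fin-∪ cov (j , hj) (k , hk) =
    j + k , λ h → [ hj ∘ AtLeast-down (n≤1+n j) , hk ]′ (AtLeast-pigeonhole j k cov h)

  Inf-∖ : ∀ {P Q R : A → Set} → (∀ w → R w → P w ⊎ Q w) → Inf R → Finite P → Inf Q
  Inf-∖ cov inf (j , hj) k =
    [ ⊥-elim ∘ hj ∘ AtLeast-down (n≤1+n j) , id ]′ (AtLeast-pigeonhole j k cov (inf (j + k)))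

  Fin-empty : ∀ {P : A → Set} → (∀ w → ¬ P w) → Finite P
  Fin-empty h = 1 , λ (w , p , _) → h w p

  Fin-singleton : ∀ {P : A → Set} u → (∀ w → P w → w ≡ u) → Finite P
  Fin-singleton u h =
    2 , λ (w , p , v , (q , ne) , _) → ne (trans (h v q) (sym (h w p)))

  Fin-⋃ : ∀ {P : A → Set} {R : A → A → Set} → Finite P → (∀ c → P c → Finite (R c)) →
    Finite (λ w → Σ A λ c → P c × R c w)
  Fin-⋃ {P} {R} (k , h) = go k P h
    where
    go : ∀ k (P : A → Set) → ¬ AtLeast k P → (∀ c → P c → Finite (R c)) →
         Finite (λ w → Σ A λ c → P c × R c w)
    go zero    P h f = contradiction tt h
    go (suc k) P h f with em {Σ A P}
    ... | no ne       = Fin-empty λ _ (c , p , _) → ne (c , p)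
    ... | yes (u , p) = Fin-∪ cov (f u p)
                          (go k (λ v → P v × ¬ v ≡ u) (λ ps → h (u , p , ps)) (λ c → f c ∘ proj₁))
      where
      cov : ∀ w → (Σ A λ c → P c × R c w) →
            R u w ⊎ (Σ A λ c → (P c × ¬ c ≡ u) × R c w)
      cov w (c , pc , r) with em {c ≡ u}
      ... | yes refl = inj₁ r
      ... | no ne    = inj₂ (c , (pc , ne) , r)

  sequence⇒Inf : ∀ {P : A → Set} (x : ℕ → A) → (∀ j → P (x j)) →
    (∀ i j → i < j → ¬ x j ≡ x i) → Inf P
  sequence⇒Inf x p inj zero    = tt
  sequence⇒Inf x p inj (suc k) =
    x 0 , p 0 , sequence⇒Inf (x ∘ suc) (λ j → p (suc j) , inj 0 (suc j) (s≤s z≤n))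
                  (λ i j i<j → inj (suc i) (suc j) (s≤s i<j)) k

  infix 4 _≈[_]_
  _≈[_]_ : (A → Set) → ℕ → (A → Set) → Set
  P ≈[ N ] Q = ∀ k → k ≤ N → AtLeast k P iff AtLeast k Q

  ≈-sym : ∀ {P Q : A → Set} {N} → P ≈[ N ] Q → Q ≈[ N ] P
  ≈-sym e k k≤N = proj₂ (e k k≤N) , proj₁ (e k k≤N)

  AtLeast⇒≈ : ∀ {P Q : A → Set} {N} → AtLeast N P → AtLeast N Q → P ≈[ N ] Q
  AtLeast⇒≈ p q k k≤N = (λ _ → AtLeast-down k≤N q) , (λ _ → AtLeast-down k≤N p)

  Exact⇒≈ : ∀ {P Q : A → Set} {j N} → Exact j P → Exact j Q → P ≈[ N ] Q
  Exact⇒≈ e e′ k _ = half e e′ , half e′ e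
    where
    half : ∀ {P Q : A → Set} {j} → Exact j P → Exact j Q → AtLeast k P → AtLeast k Q
    half {j = j} (_ , p) (q , _) h with ≤-total k j
    ... | inj₁ k≤j = AtLeast-down k≤j q
    ... | inj₂ j≤k with m≤n⇒m<n∨m≡n j≤k
    ...   | inj₁ j<k  = contradiction (AtLeast-down j<k h) p
    ...   | inj₂ refl = q

  record Splits (R P Q : A → Set) : Set where
    constructor splits
    field
      cover : ∀ w → R w → P w ⊎ Q w
      left  : ∀ w → P w → R w
      right : ∀ w → Q w → R w
      apart : ∀ w → P w → ¬ Q w
  open Splits

  Splits-sym : ∀ {R P Q : A → Set} → Splits R P Q → Splits R Q P
  Splits-sym (splits c l r a) = splits (λ w → Sum.swap ∘ c w) r l (λ w → flip (a w))

  Splits-∈ : ∀ (R P : A → Set) → Splits R (λ w → P w × R w) (λ w → (¬ P w) × R w)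
  Splits-∈ R P = splits cov (λ _ → proj₂) (λ _ → proj₂) (λ _ (p , _) (np , _) → np p)
    where
    cov : ∀ w → R w → (P w × R w) ⊎ ((¬ P w) × R w)
    cov w r with em {P w}
    ... | yes p = inj₁ (p , r)
    ... | no ¬p = inj₂ (¬p , r)

  -- Of `j + k` points of `R′`, only `j` can lie in `P′`, so the others are left for `Q′`.
  complement-AtLeast : ∀ {R P Q R′ P′ Q′ : A → Set} {j} k → Splits R P Q → Splits R′ P′ Q′ →
    Exact j P → Exact j P′ → (AtLeast (j + k) R → AtLeast (j + k) R′) →
    AtLeast k Q → AtLeast k Q′
  complement-AtLeast {j = j} k s s′ (p , _) (_ , ¬p′) f q =
    [ ⊥-elim ∘ ¬p′ , id ]′
      (AtLeast-pigeonhole j k (cover s′) (f (AtLeast-+ j k (left s) (right s) (apart s) p q)))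

  -- To compare `k ≤ N` points of the complements, `j + k` points of the wholes are compared; hence
  -- the doubled threshold.
  complement-≈ : ∀ {R P Q R′ P′ Q′ : A → Set} {j N} → Splits R P Q → Splits R′ P′ Q′ →
    R ≈[ N + N ] R′ → j < N → Exact j P → Exact j P′ → Q ≈[ N ] Q′
  complement-≈ {j = j} s s′ e j<N p p′ k k≤N =
    complement-AtLeast k s s′ p p′ (proj₁ (e (j + k) j+k≤)) ,
    complement-AtLeast k s′ s p′ p (proj₂ (e (j + k) j+k≤))
    where j+k≤ = +-mono-≤ (<⇒≤ j<N) k≤N

-- Classes and sets of a model

module Model (em : ExcludedMiddle 0ℓ) (M : ∈-Structure) (isModel : GBC.IsModel M) where
  open ∈-Structure M
  open GBC M
  open GBC.IsModel isModel
  open Counting em {Carrier}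

  pattern v0 = zero
  pattern v1 = suc v0
  pattern v2 = suc v1

  ¬f_ : ∀ {n} → Formula n → Formula n
  ¬f φ = φ ⇒f fls

  _⇔f_ : ∀ {n} → Formula n → Formula n → Formula n
  φ ⇔f ψ = (φ ⇒f ψ) ∧f (ψ ⇒f φ)

  ext : ∀ {a b} → a ⊆ b → b ⊆ a → a ≡ b
  ext {a} {b} f g = extensionality a b (λ c → f c , g c)

  infixr 7 _∩_
  infixr 6 _∪_

  _∪_ _∩_ : Carrier → Carrier → Carrier
  a ∪ b = proj₁ (comprehension 2 (rel v0 v1 ∨f rel v0 v2) (a ◂ b ◂ ⟨⟩))
  a ∩ b = proj₁ (comprehension 2 (rel v0 v1 ∧f rel v0 v2) (a ◂ b ◂ ⟨⟩))

  ∁ ❴_❵ supersets : Carrier → Carrier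
  ∁ a         = proj₁ (comprehension 1 (¬f rel v0 v1) (a ◂ ⟨⟩))
  ❴ a ❵       = proj₁ (comprehension 1 (eq v0 v1) (a ◂ ⟨⟩))
  supersets a = proj₁ (comprehension 1 (all (rel v0 v2 ⇒f rel v0 v1)) (a ◂ ⟨⟩))

  ∅ V russell : Carrier
  ∅       = proj₁ (comprehension 0 fls ⟨⟩)
  V       = proj₁ (comprehension 0 (eq v0 v0) ⟨⟩)
  russell = proj₁ (comprehension 0 (¬f rel v0 v0) ⟨⟩)

  ∈∪⁻ : ∀ {a b w} → w ∈ (a ∪ b) → w ∈ a ⊎ w ∈ b
  ∈∪⁻ h = proj₂ (proj₁ (proj₂ (comprehension 2 _ _) _) h)

  ∈∪⁺ : ∀ {a b w} → w ∈ a ⊎ w ∈ b → w ∈ (a ∪ b)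
  ∈∪⁺ h = proj₂ (proj₂ (comprehension 2 _ _) _) ([ _ ,_ , _ ,_ ]′ h , h)

  ∈∩⁻ : ∀ {a b w} → w ∈ (a ∩ b) → w ∈ a × w ∈ b
  ∈∩⁻ h = proj₂ (proj₁ (proj₂ (comprehension 2 _ _) _) h)

  ∈∩⁺ : ∀ {a b w} → w ∈ a → w ∈ b → w ∈ (a ∩ b)
  ∈∩⁺ h h′ = proj₂ (proj₂ (comprehension 2 _ _) _) ((_ , h) , h , h′)

  ∈∁⁻ : ∀ {a w} → w ∈ ∁ a → ¬ w ∈ a
  ∈∁⁻ h = proj₂ (proj₁ (proj₂ (comprehension 1 _ _) _) h)

  ∈∁⁺ : ∀ {a w} → IsSet w → ¬ w ∈ a → w ∈ ∁ a
  ∈∁⁺ s h = proj₂ (proj₂ (comprehension 1 _ _) _) (s , h)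

  ∈❴❵⁻ : ∀ {a w} → w ∈ ❴ a ❵ → w ≡ a
  ∈❴❵⁻ h = proj₂ (proj₁ (proj₂ (comprehension 1 _ _) _) h)

  ∈❴❵⁺ : ∀ {a} → IsSet a → a ∈ ❴ a ❵
  ∈❴❵⁺ s = proj₂ (proj₂ (comprehension 1 _ _) _) (s , refl)

  ∈supersets⁻ : ∀ {a w} → w ∈ supersets a → a ⊆ w
  ∈supersets⁻ h c c∈a = proj₂ (proj₁ (proj₂ (comprehension 1 _ _) _) h) c (_ , c∈a) c∈a

  ∈supersets⁺ : ∀ {a w} → IsSet w → a ⊆ w → w ∈ supersets a
  ∈supersets⁺ s h = proj₂ (proj₂ (comprehension 1 _ _) _) (s , λ c _ → h c)

  ∉∅ : ∀ {w} → ¬ w ∈ ∅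
  ∉∅ h = proj₂ (proj₁ (proj₂ (comprehension 0 _ _) _) h)

  ∈V : ∀ {w} → IsSet w → w ∈ V
  ∈V s = proj₂ (proj₂ (comprehension 0 _ _) _) (s , refl)

  ∅-set : IsSet ∅
  ∅-set with infinity
  ... | x , _ , (e , e∈x , e-empty) , _ =
    x , subst (_∈ x) (ext (λ c h → contradiction h (e-empty c))
                          (λ c h → ⊥-elim (∉∅ h))) e∈x

  pair-set : ∀ {a b} → IsSet a → IsSet b → IsSet (❴ a ❵ ∪ ❴ b ❵)
  pair-set {a} {b} sa sb with pairing a b sa sb
  ... | z , (y , z∈y) , zmem = y , subst (_∈ y) (ext z⊆ ⊆z) z∈y
    where
    z⊆ : z ⊆ (❴ a ❵ ∪ ❴ b ❵)
    z⊆ c h with proj₁ (zmem c) h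
    ... | inj₁ refl = ∈∪⁺ (inj₁ (∈❴❵⁺ sa))
    ... | inj₂ refl = ∈∪⁺ (inj₂ (∈❴❵⁺ sb))
    ⊆z : (❴ a ❵ ∪ ❴ b ❵) ⊆ z
    ⊆z c h = proj₂ (zmem c) (Sum.map ∈❴❵⁻ ∈❴❵⁻ (∈∪⁻ h))

  ❴❵-set : ∀ {a} → IsSet a → IsSet ❴ a ❵
  ❴❵-set {a} sa = subst IsSet (ext (λ _ → [ id , id ]′ ∘ ∈∪⁻) (λ _ → ∈∪⁺ ∘ inj₁)) (pair-set sa sa)

  ∪-set : ∀ {a b} → IsSet a → IsSet b → IsSet (a ∪ b)
  ∪-set {a} {b} sa sb with union _ (pair-set sa sb)
  ... | u , (y , u∈y) , umem = y , subst (_∈ y) (ext u⊆ ⊆u) u∈y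
    where
    u⊆ : u ⊆ (a ∪ b)
    u⊆ c h with proj₁ (umem c) h
    ... | v , v∈ , c∈v with ∈∪⁻ v∈
    ...   | inj₁ v≡a = ∈∪⁺ (inj₁ (subst (c ∈_) (∈❴❵⁻ v≡a) c∈v))
    ...   | inj₂ v≡b = ∈∪⁺ (inj₂ (subst (c ∈_) (∈❴❵⁻ v≡b) c∈v))
    ⊆u : (a ∪ b) ⊆ u
    ⊆u c h with ∈∪⁻ h
    ... | inj₁ c∈a = proj₂ (umem c) (a , ∈∪⁺ (inj₁ (∈❴❵⁺ sa)) , c∈a)
    ... | inj₂ c∈b = proj₂ (umem c) (b , ∈∪⁺ (inj₂ (∈❴❵⁺ sb)) , c∈b)

  ⊆-set : ∀ {a b} → IsSet b → a ⊆ b → IsSet a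
  ⊆-set {a} {b} sb a⊆b with separation b a sb
  ... | y , (z , y∈z) , ymem =
    z , subst (_∈ z) (ext (λ c → proj₂ ∘ proj₁ (ymem c))
                          (λ c h → proj₂ (ymem c) (a⊆b c h , h))) y∈z

  -- `P` is a predicate of the metatheory, out of reach of comprehension; its finitely many elements
  -- are adjoined one by one.
  set-of : ∀ {P : Carrier → Set} → (∀ w → P w → IsSet w) → Finite P →
    Σ Carrier λ y → IsSet y × (∀ w → w ∈ y iff P w)
  set-of {P} sets (k , h) = go k P sets h
    where
    go : ∀ k (P : Carrier → Set) → (∀ w → P w → IsSet w) → ¬ AtLeast k P →
         Σ Carrier λ y → IsSet y × (∀ w → w ∈ y iff P w)
    go zero    P sets h = contradiction tt h
    go (suc k) P sets h with em {Σ Carrier P}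
    ... | no empty = ∅ , ∅-set , λ w → ⊥-elim ∘ ∉∅ , (λ p → contradiction (w , p) empty)
    ... | yes (u , pu) with go k (λ v → P v × ¬ v ≡ u) (λ w → sets w ∘ proj₁) (λ ps → h (u , pu , ps))
    ...   | y , y-set , y-mem =
      y ∪ ❴ u ❵ , ∪-set y-set (❴❵-set (sets u pu)) , λ w →
        (λ w∈ → [ (λ w∈y → proj₁ (proj₁ (y-mem w) w∈y)) , (λ w∈u → subst P (sym (∈❴❵⁻ w∈u)) pu) ]′ (∈∪⁻ w∈)) ,
        from w
      where
      from : ∀ w → P w → w ∈ (y ∪ ❴ u ❵)
      from w p with em {w ≡ u}
      ... | yes refl = ∈∪⁺ (inj₂ (∈❴❵⁺ (sets u p)))
      ... | no ne    = ∈∪⁺ (inj₁ (proj₂ (y-mem w) (p , ne)))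

  Fin⇒set : ∀ {a} → Finite (_∈ a) → IsSet a
  Fin⇒set {a} fin with set-of (λ w w∈a → a , w∈a) fin
  ... | y , y-set , y-mem = ⊆-set y-set (λ c → proj₂ (y-mem c))

  -- With finitely many classes, the Russell class would have finitely many elements and so be a
  -- set, which is contradictory.
  infinite : Infinite Carrier
  infinite (n , f , surj) = russell∉ russell∈
    where
    atMost : ∀ n (f : Fin n → Carrier) {P : Carrier → Set} →
      (∀ x → P x → Σ (Fin n) λ i → f i ≡ x) → Finite P
    atMost zero    f s = Fin-empty λ w p → case0 (proj₁ (s w p))
      where
      case0 : Fin 0 → ⊥
      case0 ()
    atMost (suc n) f {P} s =
      Fin-∪ {P = _≡ f zero} cov (Fin-singleton (f zero) (λ _ → id))
        (atMost n (f ∘ suc) (λ _ → id))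
      where
      cov : ∀ w → P w → w ≡ f zero ⊎ (Σ (Fin n) λ i → f (suc i) ≡ w)
      cov w p with s w p
      ... | zero  , e = inj₁ (sym e)
      ... | suc i , e = inj₂ (i , e)
    russell-set : IsSet russell
    russell-set = Fin⇒set (atMost n f λ x _ → surj x)
    russell∉ : ¬ russell ∈ russell
    russell∉ h = proj₂ (proj₁ (proj₂ (comprehension 0 _ _) _) h) h
    russell∈ : russell ∈ russell
    russell∈ = proj₂ (proj₂ (comprehension 0 _ _) _) (russell-set , russell∉)

  -- The atomic Boolean algebra of classes

  atomicBooleanAlgebra : IsAtomicBooleanAlgebra _⊆_
  atomicBooleanAlgebra = record
    { _∨_ = _∪_ ; _∧_ = _∩_ ; ¬′_ = ∁ ; top = V ; bot = ∅
    ; isBooleanAlgebra = record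
      { isHeytingAlgebra = record
        { isBoundedLattice = record
          { isLattice = record
            { isPartialOrder = record
              { isPreorder = record
                { isEquivalence = isEquivalence
                ; reflexive     = λ { refl _ h → h }
                ; trans         = λ f g c → g c ∘ f c
                }
              ; antisym = ext
              }
            ; supremum = λ x y → (λ _ → ∈∪⁺ ∘ inj₁) , (λ _ → ∈∪⁺ ∘ inj₂) ,
                           λ z f g c → [ f c , g c ]′ ∘ ∈∪⁻
            ; infimum  = λ x y → (λ _ → proj₁ ∘ ∈∩⁻) , (λ _ → proj₂ ∘ ∈∩⁻) ,
                           λ z f g c h → ∈∩⁺ (f c h) (g c h)
            }
          ; maximum = λ x c h → ∈V (x , h)
          ; minimum = λ x c → ⊥-elim ∘ ∉∅
          }
        ; exponential = λ w x y → curry w x y , uncurry w x y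
        }
      }
    ; atomic = atomic
    }
    where
    curry : ∀ w x y → (w ∩ x) ⊆ y → w ⊆ (∁ x ∪ y)
    curry w x y f c c∈w with em {c ∈ x}
    ... | yes c∈x = ∈∪⁺ (inj₂ (f c (∈∩⁺ c∈w c∈x)))
    ... | no c∉x  = ∈∪⁺ (inj₁ (∈∁⁺ (w , c∈w) c∉x))
    uncurry : ∀ w x y → w ⊆ (∁ x ∪ y) → (w ∩ x) ⊆ y
    uncurry w x y f c h with ∈∪⁻ (f c (proj₁ (∈∩⁻ h)))
    ... | inj₁ c∈∁x = contradiction (proj₂ (∈∩⁻ h)) (∈∁⁻ c∈∁x)
    ... | inj₂ c∈y  = c∈y
    atomic : ∀ x → ¬ x ≡ ∅ → Σ Carrier λ a →
      ((¬ a ≡ ∅) × (∀ b → b ⊆ a → b ≡ ∅ ⊎ b ≡ a)) × a ⊆ x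
    atomic x x≢∅ with em {Σ Carrier (_∈ x)}
    ... | no empty = contradiction (ext (λ c c∈x → contradiction (c , c∈x) empty) (λ _ → ⊥-elim ∘ ∉∅)) x≢∅
    ... | yes (u , u∈x) =
      ❴ u ❵ , ((λ e → ∉∅ (subst (u ∈_) e u∈❴u❵)) , minimal) ,
      λ c c∈ → subst (_∈ x) (sym (∈❴❵⁻ c∈)) u∈x
      where
      u∈❴u❵ : u ∈ ❴ u ❵
      u∈❴u❵ = ∈❴❵⁺ (x , u∈x)
      minimal : ∀ b → b ⊆ ❴ u ❵ → b ≡ ∅ ⊎ b ≡ ❴ u ❵
      minimal b f with em {u ∈ b}
      ... | yes u∈b = inj₂ (ext f λ c c∈ → subst (_∈ b) (sym (∈❴❵⁻ c∈)) u∈b)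
      ... | no u∉b  = inj₁ (ext (λ c c∈b → contradiction (subst (_∈ b) (∈❴❵⁻ (f c c∈b)) c∈b) u∉b)
                                (λ _ → ⊥-elim ∘ ∉∅))

  -- Splitting an infinite class

  Relation₂ : Set₁
  Relation₂ = Carrier → Carrier → Set

  -- Quantifiers in the predicates below range over sets, so that a predicate is definitionally
  -- the satisfaction of the relativization of the formula of the same name with suffix F.
  Grow Grow² : Relation₂ → Relation₂
  Grow κ s t  = ∀ w → IsSet w → w ∈ t iff (w ∈ s ⊎ κ s w)
  Grow² κ s u = Σ Carrier λ t → IsSet t × (Grow κ s t × Grow κ t u)

  -- Reachable κ X says that X is an even stage of the growth from ∅.  Bounding the stages by X
  -- replaces recursion along ω; nonstandard X may be reachable too.
  Reachable Alternate : Relation₂ → Carrier → Set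
  Reachable κ X = ∀ T → IsSet T →
    (∀ e → IsSet e → (∀ v → IsSet v → v ∈ e → ⊥) → e ∈ T) →
    (∀ Y → IsSet Y → Y ∈ T → ∀ Z → IsSet Z → Grow² κ Y Z →
      (∀ w → IsSet w → w ∈ Z → w ∈ X) → Z ∈ T) →
    X ∈ T
  Alternate κ x = Σ Carrier λ X → IsSet X × (Reachable κ X × κ X x)

  -- The variables are arguments, so that a formula moves under a binder by shifting them, without a
  -- renaming operation.
  FormulaFamily : Set
  FormulaFamily = ∀ {n} (A C s x : Fin n) → Formula n

  growF grow²F : FormulaFamily → ∀ {n} (A C s t : Fin n) → Formula n
  growF κF A C s t  = all (rel v0 (suc t) ⇔f (rel v0 (suc s) ∨f κF (suc A) (suc C) (suc s) v0))
  grow²F κF A C s u = ex (growF κF (suc A) (suc C) (suc s) v0 ∧f growF κF (suc A) (suc C) v0 (suc u))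

  reachableF : FormulaFamily → ∀ {n} (A C X : Fin n) → Formula n
  reachableF κF A C X = all
    (all (all (rel v0 v1 ⇒f fls) ⇒f rel v0 v1) ⇒f
    (all (rel v0 v1 ⇒f all (grow²F κF (3+ A) (3+ C) v1 v0 ⇒f
      (all (rel v0 v1 ⇒f rel v0 (suc (3+ X))) ⇒f rel v0 v2))) ⇒f
    rel (suc X) v0))
    where
    3+_ : ∀ {n} → Fin n → Fin (3 + n)
    3+ i = suc (suc (suc i))

  -- The free variables are `x`, `A`, `C`, in this order; the quantifier puts the stage `X` in front
  -- of them.
  alternateF : FormulaFamily → Formula 3
  alternateF κF = ex (reachableF κF v2 (suc v2) v0 ∧f κF v2 (suc v2) v0 v1)

  -- The definability of `κ` enters only through `B`, so that chosen points and kings are treated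
  -- alike. `κ-step` concerns the stages that are finite in the metatheory, which are those that
  -- recursion on `ℕ` visits.
  module Alternation (A : Carrier) (κ : Relation₂)
    (κ-new  : ∀ {s x} → κ s x → x ∈ A × ¬ x ∈ s)
    (κ-step : ∀ s → IsSet s → s ⊆ A → Finite (_∈ s) → Σ Carrier (κ s) × Finite (κ s))
    (B : Carrier) (B-mem : ∀ x → x ∈ B iff (IsSet x × Alternate κ x)) where

    record Stage : Set where
      constructor mkStage
      field
        set    : Carrier
        isSet  : IsSet set
        within : set ⊆ A
        finite : Finite (_∈ set)

      pick : Carrier
      pick = proj₁ (proj₁ (κ-step set isSet within finite))

      pick-κ : κ set pick
      pick-κ = proj₂ (proj₁ (κ-step set isSet within finite))

      pick∈A : pick ∈ A
      pick∈A = proj₁ (κ-new pick-κ)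
    open Stage

    Larger : Stage → Set
    Larger S = Σ Stage λ S′ → Grow κ (set S) (set S′)

    -- Unfolding the stages makes conversion checking explode.
    abstract
      larger : ∀ S → Larger S
      larger (mkStage s s-set s⊆A s-fin) with
        set-of {λ w → w ∈ s ⊎ κ s w} (λ w → [ s ,_ , (λ k → A , proj₁ (κ-new k)) ]′)
               (Fin-∪ (λ _ → id) s-fin (proj₂ (κ-step s s-set s⊆A s-fin)))
      ... | t , t-set , t-mem =
        mkStage t t-set (λ c c∈t → [ s⊆A c , proj₁ ∘ κ-new ]′ (proj₁ (t-mem c) c∈t))
          (Fin-∪ (λ w → proj₁ (t-mem w)) s-fin (proj₂ (κ-step s s-set s⊆A s-fin))) ,
        λ w _ → t-mem w

    next : Stage → Stage
    next S = proj₁ (larger S)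

    even odd : ℕ → Stage
    even zero    = mkStage ∅ ∅-set (λ _ → ⊥-elim ∘ ∉∅) (Fin-empty λ _ → ∉∅)
    even (suc j) = next (odd j)
    odd j        = next (even j)

    D E : ℕ → Carrier
    D j = set (even j)
    E j = set (odd j)

    Grow-⊆ : ∀ {s t} → Grow κ s t → s ⊆ t
    Grow-⊆ {s} g c c∈s = proj₂ (g c (s , c∈s)) (inj₁ c∈s)

    Grow-functional : ∀ {s t t′} → Grow κ s t → Grow κ s t′ → t ≡ t′
    Grow-functional g g′ = ext (half g g′) (half g′ g)
      where
      half : ∀ {s t t′} → Grow κ s t → Grow κ s t′ → t ⊆ t′
      half {t = t} g g′ c c∈t = proj₂ (g′ c (t , c∈t)) (proj₁ (g c (t , c∈t)) c∈t)

    Grow²-functional : ∀ {s u u′} → Grow² κ s u → Grow² κ s u′ → u ≡ u′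
    Grow²-functional (t , _ , g , h) (t′ , _ , g′ , h′) with Grow-functional g g′
    ... | refl = Grow-functional h h′

    D⊆E : ∀ j → D j ⊆ E j
    D⊆E j = Grow-⊆ (proj₂ (larger (even j)))

    E⊆D : ∀ j → E j ⊆ D (suc j)
    E⊆D j = Grow-⊆ (proj₂ (larger (odd j)))

    D-grow : ∀ j → Grow² κ (D j) (D (suc j))
    D-grow j = E j , isSet (odd j) , proj₂ (larger (even j)) , proj₂ (larger (odd j))

    D-mono : ∀ {i j} → i ≤ j → D i ⊆ D j
    D-mono {i} {zero} z≤n c h = h
    D-mono {i} {suc j} i≤ c h with m≤n⇒m<n∨m≡n i≤
    ... | inj₁ (s≤s i≤j) = E⊆D j c (D⊆E j c (D-mono i≤j c h))
    ... | inj₂ refl      = h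

    E-mono : ∀ {i j} → i ≤ j → E i ⊆ E j
    E-mono {i} {j} i≤j c h with m≤n⇒m<n∨m≡n i≤j
    ... | inj₁ i<j  = D⊆E j c (D-mono i<j c (E⊆D i c h))
    ... | inj₂ refl = h

    -- The stages before `D j` are all contained in it, so the bound in `Reachable` does not stop
    -- the induction.
    D-reachable : ∀ j → Reachable κ (D j)
    D-reachable j T T-set base closed = go j ≤-refl
      where
      go : ∀ i → i ≤ j → D i ∈ T
      go zero    _   = base ∅ ∅-set (λ v _ → ∉∅)
      go (suc i) i<j = closed (D i) (isSet (even i)) (go i (<⇒≤ i<j)) (D (suc i))
                         (isSet (even (suc i))) (D-grow i) (λ w _ → D-mono i<j w)

    firsts : ℕ → Carrier
    firsts zero    = ❴ D 0 ❵
    firsts (suc i) = firsts i ∪ ❴ D (suc i) ❵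

    ∈firsts⁻ : ∀ i {w} → w ∈ firsts i → Σ ℕ λ j → j ≤ i × w ≡ D j
    ∈firsts⁻ zero    h = 0 , z≤n , ∈❴❵⁻ h
    ∈firsts⁻ (suc i) h with ∈∪⁻ h
    ... | inj₂ h′ = suc i , ≤-refl , ∈❴❵⁻ h′
    ... | inj₁ h′ with ∈firsts⁻ i h′
    ...   | j , j≤i , e = j , m≤n⇒m≤1+n j≤i , e

    ∈firsts⁺ : ∀ i j → j ≤ i → D j ∈ firsts i
    ∈firsts⁺ zero    zero z≤n = ∈❴❵⁺ (isSet (even 0))
    ∈firsts⁺ (suc i) j j≤ with m≤n⇒m<n∨m≡n j≤
    ... | inj₁ (s≤s j≤i) = ∈∪⁺ (inj₁ (∈firsts⁺ i j j≤i))
    ... | inj₂ refl      = ∈∪⁺ (inj₂ (∈❴❵⁺ (isSet (even j))))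

    -- This is what controls nonstandard stages. The subsets of `X` that are among `D 0`, ..., `D i`
    -- or contain `D (suc i)` include `∅` and are closed under double growth inside `X`, so `X` is
    -- one of them.
    reachable-dichotomy : ∀ i {X} → IsSet X → Reachable κ X →
      (Σ ℕ λ j → j ≤ i × X ≡ D j) ⊎ D (suc i) ⊆ X
    reachable-dichotomy i {X} X-set reach with powerSet X X-set
    -- `Reachable` admits only sets `T`; the power set of `X` makes this one a set, as growth is
    -- bounded by `X`.
    ... | P , P-set , P-mem with separation P (firsts i ∪ supersets (D (suc i))) P-set
    ...   | T , T-set , T-mem =
      Sum.map (∈firsts⁻ i) ∈supersets⁻ (∈∪⁻ (proj₂ (proj₁ (T-mem X) (reach T T-set base closed))))
      where
      base : ∀ e → IsSet e → (∀ v → IsSet v → v ∈ e → ⊥) → e ∈ T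
      base e e-set empty with ext {e} {∅} (λ c c∈e → ⊥-elim (empty c (e , c∈e) c∈e)) (λ _ → ⊥-elim ∘ ∉∅)
      ... | refl = proj₂ (T-mem ∅) (proj₂ (P-mem ∅) (∅-set , λ _ → ⊥-elim ∘ ∉∅) ,
                                    ∈∪⁺ (inj₁ (∈firsts⁺ i 0 z≤n)))
      closed : ∀ Y → IsSet Y → Y ∈ T → ∀ Z → IsSet Z → Grow² κ Y Z →
        (∀ w → IsSet w → w ∈ Z → w ∈ X) → Z ∈ T
      closed Y _ Y∈T Z Z-set g@(t , _ , g₁ , g₂) Z⊆X =
        proj₂ (T-mem Z) (proj₂ (P-mem Z) (Z-set , λ c c∈Z → Z⊆X c (Z , c∈Z) c∈Z) ,
          ∈∪⁺ ([ after-first , after-superset ]′ (∈∪⁻ (proj₂ (proj₁ (T-mem Y) Y∈T)))))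
        where
        after-first : Y ∈ firsts i → Z ∈ firsts i ⊎ Z ∈ supersets (D (suc i))
        after-first h with ∈firsts⁻ i h
        ... | j , j≤i , refl with Grow²-functional g (D-grow j) | m≤n⇒m<n∨m≡n j≤i
        ...   | refl | inj₁ j<i  = inj₁ (∈firsts⁺ i (suc j) j<i)
        ...   | refl | inj₂ refl = inj₂ (∈supersets⁺ Z-set (λ _ → id))
        after-superset : Y ∈ supersets (D (suc i)) → Z ∈ firsts i ⊎ Z ∈ supersets (D (suc i))
        after-superset h = inj₂ (∈supersets⁺ Z-set λ c c∈D →
          Grow-⊆ g₂ c (Grow-⊆ g₁ c (∈supersets⁻ h c c∈D)))

    κ⊆next : ∀ S x → κ (set S) x → x ∈ set (next S)
    κ⊆next S x k = proj₂ (proj₂ (larger S) x (A , proj₁ (κ-new k))) (inj₂ k)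

    -- The point picked at `S i` has entered by stage `S j`, whereas the one picked at `S j` is new
    -- there.
    distinct : (S : ℕ → Stage) → (∀ i j → i < j → set (next (S i)) ⊆ set (S j)) →
      ∀ i j → i < j → ¬ pick (S j) ≡ pick (S i)
    distinct S mono i j i<j e = proj₂ (κ-new (pick-κ (S j)))
      (subst (_∈ set (S j)) (sym e) (mono i j i<j _ (κ⊆next (S i) _ (pick-κ (S i)))))

    inside : Inf (λ w → w ∈ B × w ∈ A)
    inside = sequence⇒Inf (pick ∘ even)
      (λ j → proj₂ (B-mem _) ((A , pick∈A (even j)) , D j , isSet (even j) , D-reachable j , pick-κ (even j)) ,
             pick∈A (even j))
      (distinct even λ i j i<j c → D-mono i<j c ∘ E⊆D i c)

    outside : Inf (λ w → (¬ w ∈ B) × w ∈ A)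
    outside = sequence⇒Inf (pick ∘ odd) (λ j → ∉B j , pick∈A (odd j))
      (distinct odd λ i j i<j c → D⊆E j c ∘ D-mono i<j c)
      where
      ∉B : ∀ j → ¬ pick (odd j) ∈ B
      ∉B j h with proj₁ (B-mem _) h
      -- The point is new to `E j` and belongs to `D (suc j)`. A stage `X` containing `D (suc j)`
      -- has it already; a stage `D i` with `i ≤ j` would have put it into `E i`, inside `E j`.
      ... | _ , X , X-set , reach , k with reachable-dichotomy j X-set reach
      ...   | inj₂ D⊆X = proj₂ (κ-new k) (D⊆X _ (κ⊆next (odd j) _ (pick-κ (odd j))))
      ...   | inj₁ (i , i≤j , refl) = proj₂ (κ-new (pick-κ (odd j))) (E-mono i≤j _ (κ⊆next (even i) _ k))

  -- The tournament given by global choice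

  UPair OrdPair : Carrier → Carrier → Carrier → Set
  UPair z a b   = ∀ t → IsSet t → t ∈ z iff (t ≡ a ⊎ t ≡ b)
  OrdPair p a b = ∀ z → IsSet z → z ∈ p iff (UPair z a a ⊎ UPair z a b)

  -- `Beats` is the tournament relation: the winner is what global choice takes from the unordered
  -- pair. Each set beats itself.
  Chooses Beats : Carrier → Relation₂
  Chooses C y x = Σ Carrier λ p → IsSet p × (p ∈ C × OrdPair p y x)
  Beats C a b   = Σ Carrier λ y → IsSet y × (UPair y a b × Chooses C y a)

  upairF ordPairF : ∀ {n} → Fin n → Fin n → Fin n → Formula n
  upairF z a b   = all (rel v0 (suc z) ⇔f (eq v0 (suc a) ∨f eq v0 (suc b)))
  ordPairF p a b = all (rel v0 (suc p) ⇔f (upairF v0 (suc a) (suc a) ∨f upairF v0 (suc a) (suc b)))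

  choosesF beatsF : ∀ {n} → Fin n → Fin n → Fin n → Formula n
  choosesF C y x = ex (rel v0 (suc C) ∧f ordPairF v0 (suc y) (suc x))
  beatsF C a b   = ex (upairF v0 (suc a) (suc b) ∧f choosesF (suc C) v0 (suc a))

  UPair⇒IsUPair : ∀ {z a b} → IsSet a → IsSet b → UPair z a b → IsUPair z a b
  UPair⇒IsUPair {z} sa sb u t =
    (λ t∈z → proj₁ (u t (z , t∈z)) t∈z) ,
    (λ e → proj₂ (u t ([ (λ { refl → sa }) , (λ { refl → sb }) ]′ e)) e)

  IsUPair⇒set : ∀ {z a b} → IsSet a → IsSet b → IsUPair z a b → IsSet z
  IsUPair⇒set sa sb u = subst IsSet
    (ext (λ c c∈ → proj₂ (u c) (Sum.map ∈❴❵⁻ ∈❴❵⁻ (∈∪⁻ c∈)))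
         (λ c c∈ → ∈∪⁺ (Sum.map (λ { refl → ∈❴❵⁺ sa }) (λ { refl → ∈❴❵⁺ sb }) (proj₁ (u c) c∈))))
    (pair-set sa sb)

  OrdPair⇒IsOrdPair : ∀ {p a b} → IsSet a → IsSet b → OrdPair p a b → IsOrdPair p a b
  OrdPair⇒IsOrdPair {p} sa sb o z =
    (λ z∈p → Sum.map (UPair⇒IsUPair sa sa) (UPair⇒IsUPair sa sb) (proj₁ (o z (p , z∈p)) z∈p)) ,
    (λ e → proj₂ (o z ([ IsUPair⇒set sa sa , IsUPair⇒set sa sb ]′ e))
             (Sum.map (λ u t _ → u t) (λ u t _ → u t) e))

  IsOrdPair⇒OrdPair : ∀ {p a b} → IsSet a → IsSet b → IsOrdPair p a b → OrdPair p a b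
  IsOrdPair⇒OrdPair sa sb o z _ =
    (λ z∈p → Sum.map (λ u t _ → u t) (λ u t _ → u t) (proj₁ (o z) z∈p)) ,
    (λ e → proj₂ (o z) (Sum.map (UPair⇒IsUPair sa sa) (UPair⇒IsUPair sa sb) e))

  C : Carrier
  C = proj₁ globalChoice

  chosen : ∀ {y} → IsSet y → Σ Carrier (_∈ y) → Σ Carrier λ x → x ∈ y × Chooses C y x
  chosen {y} y-set ne with proj₂ (proj₂ globalChoice) y y-set ne
  ... | x , p , x∈y , p∈C , o =
    x , x∈y , p , (C , p∈C) , p∈C , IsOrdPair⇒OrdPair y-set (y , x∈y) o

  chosen-unique : ∀ {y a b} → IsSet y → IsSet a → IsSet b →
    Chooses C y a → Chooses C y b → a ≡ b
  chosen-unique sy sa sb (p , _ , p∈C , o) (q , _ , q∈C , o′) =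
    proj₂ (proj₁ (proj₂ globalChoice)) p q _ _ _ p∈C q∈C
      (OrdPair⇒IsOrdPair sy sa o) (OrdPair⇒IsOrdPair sy sb o′)

  Beats-total : ∀ {a b} → IsSet a → IsSet b → Beats C a b ⊎ Beats C b a
  Beats-total {a} {b} sa sb
    with chosen (pair-set sa sb) (a , ∈∪⁺ (inj₁ (∈❴❵⁺ sa)))
  ... | x , x∈ , ch = Sum.map
    (λ e → _ , pair-set sa sb , pairing-ab , subst (Chooses C _) (∈❴❵⁻ e) ch)
    (λ e → _ , pair-set sa sb , pairing-ba , subst (Chooses C _) (∈❴❵⁻ e) ch)
    (∈∪⁻ x∈)
    where
    pairing-ab : UPair (❴ a ❵ ∪ ❴ b ❵) a b
    pairing-ab t st =
      (Sum.map ∈❴❵⁻ ∈❴❵⁻ ∘ ∈∪⁻) ,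
      (∈∪⁺ ∘ Sum.map (λ { refl → ∈❴❵⁺ sa }) (λ { refl → ∈❴❵⁺ sb }))
    pairing-ba : UPair (❴ a ❵ ∪ ❴ b ❵) b a
    pairing-ba t st = Sum.swap ∘ proj₁ (pairing-ab t st) , proj₂ (pairing-ab t st) ∘ Sum.swap

  Beats-antisym : ∀ {a b} → IsSet a → IsSet b → Beats C a b → Beats C b a → a ≡ b
  Beats-antisym {a} {b} sa sb (y , sy , u , ch) (y′ , sy′ , u′ , ch′)
    with ext {y} {y′}
           (λ c c∈ → proj₂ (u′ c (y , c∈)) (Sum.swap (proj₁ (u c (y , c∈)) c∈)))
           (λ c c∈ → proj₂ (u c (y′ , c∈)) (Sum.swap (proj₁ (u′ c (y′ , c∈)) c∈)))
  ... | refl = chosen-unique sy sa sb ch ch′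

  -- Cutting sets, tournaments and classes

  Splittable : Carrier → Set
  Splittable A = Σ Carrier λ B → Inf (λ w → w ∈ B × w ∈ A) × Inf (λ w → (¬ w ∈ B) × w ∈ A)

  Splittable-mono : ∀ {A A′} → A ⊆ A′ → Splittable A → Splittable A′
  Splittable-mono sub (B , i , o) =
    B , Inf-mono (λ w → map₂ (sub w)) i , Inf-mono (λ w → map₂ (sub w)) o

  Outside : Carrier → Relation₂
  Outside A s w = w ∈ A × (w ∈ s → ⊥)

  infinite∖finite : ∀ {A s} → Inf (_∈ A) → Finite (_∈ s) → Inf (Outside A s)
  infinite∖finite {A} {s} inf fin = Inf-∖ cov inf fin
    where
    cov : ∀ w → w ∈ A → w ∈ s ⊎ Outside A s w
    cov w w∈A with em {w ∈ s}
    ... | yes h = inj₁ h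
    ... | no ¬h = inj₂ (w∈A , ¬h)

  -- The set `y` is `A` without `s`; this growth serves for sets `A` and adds a single point at a
  -- time.
  ChosenOutside : Carrier → Carrier → Relation₂
  ChosenOutside A C s x = Σ Carrier λ y → IsSet y ×
    ((∀ w → IsSet w → w ∈ y iff Outside A s w) × (x ∈ y × Chooses C y x))

  chosenOutsideF : FormulaFamily
  chosenOutsideF A C s x = ex
    (all (rel v0 v1 ⇔f (rel v0 (suc (suc A)) ∧f (rel v0 (suc (suc s)) ⇒f fls))) ∧f
    (rel (suc x) v0 ∧f choosesF (suc C) v0 (suc x)))

  infinite-set-splits : ∀ A → IsSet A → Inf (_∈ A) → Splittable A
  infinite-set-splits A A-set inf = B , inside , outside
    where
    κ : Relation₂
    κ = ChosenOutside A C
    family : Σ Carrier λ B → ∀ x → x ∈ B iff (IsSet x × Alternate κ x)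
    family = comprehension 2 (alternateF chosenOutsideF) (A ◂ C ◂ ⟨⟩)
    B : Carrier
    B = proj₁ family
    κ-new : ∀ {s x} → κ s x → x ∈ A × ¬ x ∈ s
    κ-new {x = x} (y , _ , y-mem , x∈y , _) = proj₁ (y-mem x (y , x∈y)) x∈y
    κ-unique : ∀ {s a b} → κ s a → κ s b → a ≡ b
    κ-unique (y , sy , ym , a∈y , ch) (y′ , sy′ , ym′ , b∈y′ , ch′)
      with ext {y} {y′} (λ c c∈ → proj₂ (ym′ c (y , c∈)) (proj₁ (ym c (y , c∈)) c∈))
                        (λ c c∈ → proj₂ (ym c (y′ , c∈)) (proj₁ (ym′ c (y′ , c∈)) c∈))
    ... | refl = chosen-unique sy (y , a∈y) (y , b∈y′) ch ch′
    κ-step : ∀ s → IsSet s → s ⊆ A → Finite (_∈ s) → Σ Carrier (κ s) × Finite (κ s)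
    κ-step s s-set s⊆A fin with infinite∖finite inf fin 1
    ... | u , (u∈A , u∉s) , _
      with chosen {A ∩ ∁ s} (⊆-set A-set (λ _ → proj₁ ∘ ∈∩⁻)) (u , ∈∩⁺ u∈A (∈∁⁺ (A , u∈A) u∉s))
    ...   | x , x∈ , ch = (x , κx) , Fin-singleton x (λ _ k → κ-unique k κx)
      where
      κx : κ s x
      κx = A ∩ ∁ s , ⊆-set A-set (λ _ → proj₁ ∘ ∈∩⁻) ,
        (λ w sw → (λ h → proj₁ (∈∩⁻ h) , ∈∁⁻ (proj₂ (∈∩⁻ h))) ,
                  (λ (w∈A , w∉s) → ∈∩⁺ w∈A (∈∁⁺ sw w∉s))) , x∈ , ch
    open Alternation A κ κ-new κ-step B (proj₂ family)

  -- Kings are a definable substitute for a chosen point where `A` without `s` is a proper class, to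
  -- which the choice function does not apply directly.
  King : Carrier → Relation₂ → Relation₂
  King A T s x = Outside A s x × (∀ b → IsSet b → Outside A s b →
    Σ Carrier λ c → IsSet c × (Outside A s c × (T b c × T c x)))

  kingF : (∀ {n} (C a b : Fin n) → Formula n) → FormulaFamily
  kingF tF A C s x = outsideF A s x ∧f all (outsideF (suc A) (suc s) v0 ⇒f
    ex (outsideF (suc (suc A)) (suc (suc s)) v0 ∧f (tF (suc (suc C)) v1 v0 ∧f tF (suc (suc C)) v0 (suc (suc x)))))
    where
    outsideF : ∀ {n} (A s w : Fin n) → Formula n
    outsideF A s w = rel w A ∧f (rel w s ⇒f fls)

  -- Fix `u` in `A` outside `s`. Descent along out-degrees from `u` ends in a king, and all kings
  -- lie within two steps of `u`, so they are finitely many.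
  tournament-splits : ∀ A (T : Relation₂) → Inf (_∈ A) →
    (∀ {a b} → IsSet a → IsSet b → T a b ⊎ T b a) →
    (∀ {a b} → IsSet a → IsSet b → T a b → T b a → a ≡ b) →
    (∀ a → a ∈ A → Finite (λ w → w ∈ A × T a w)) →
    (Σ Carrier λ B → ∀ x → x ∈ B iff (IsSet x × Alternate (King A T) x)) →
    Splittable A
  tournament-splits A T inf total antisym loc-fin (B , B-mem) = B , inside , outside
    where
    -- A point that is not a king beats some b of strictly smaller out-degree.
    find-king : ∀ k s a → Outside A s a → ¬ AtLeast k (λ w → Outside A s w × T a w) →
      Σ Carrier (King A T s)
    find-king zero    s a out h = contradiction tt h
    find-king (suc k) s a out h with em {King A T s a}
    ... | yes king = a , king
    ... | no ¬king with ¬∀⇒∃¬ {P = λ b → IsSet b → Outside A s b →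
                          Σ Carrier λ c → IsSet c × (Outside A s c × (T b c × T c a))}
                          (λ all-b → ¬king (out , all-b))
    ...   | b , ¬b with em {IsSet b × Outside A s b}
    ...     | no ¬sb = contradiction (λ sb ob → contradiction (sb , ob) ¬sb) ¬b
    -- No path of two steps leads from `b` to `a`. Hence every out-neighbour of `b` is one of `a`,
    -- while `a` is an out-neighbour of itself but not of `b`.
    ...     | yes (sb , ob) = find-king k s b ob λ bs →
      h (a , (out , T-refl) , AtLeast-mono k smaller bs)
      where
      outside⇒set : ∀ {w} → Outside A s w → IsSet w
      outside⇒set (w∈A , _) = A , w∈A
      T-refl : T a a
      T-refl = [ id , id ]′ (total (outside⇒set out) (outside⇒set out))
      no-path : ∀ {c} → Outside A s c → T b c → T c a → ⊥
      no-path oc tbc tca = ¬b λ _ _ → _ , outside⇒set oc , oc , tbc , tca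
      smaller : ∀ v → Outside A s v × T b v → (Outside A s v × T a v) × ¬ v ≡ a
      smaller v (ov , tbv) =
        (ov , [ id , ⊥-elim ∘ no-path ov tbv ]′ (total (outside⇒set out) (outside⇒set ov))) ,
        λ { refl → no-path ov tbv T-refl }

    κ-step : ∀ s → IsSet s → s ⊆ A → Finite (_∈ s) → Σ Carrier (King A T s) × Finite (King A T s)
    κ-step s _ _ fin with infinite∖finite inf fin 1
    ... | u , out@(u∈A , _) , _ =
      find-king _ s u out (proj₂ (Fin-mono (λ w ((w∈A , _) , t) → w∈A , t) (loc-fin u u∈A))) ,
      Fin-mono two-steps (Fin-⋃ (loc-fin u u∈A) (λ c (c∈A , _) → loc-fin c c∈A))
      where
      two-steps : ∀ w → King A T s w → Σ Carrier λ c → (c ∈ A × T u c) × (w ∈ A × T c w)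
      two-steps w ((w∈A , _) , reach) with reach u (A , u∈A) out
      ... | c , _ , (c∈A , _) , tuc , tcw = c , (c∈A , tuc) , (w∈A , tcw)

    open Alternation A (King A T) proj₁ κ-step B B-mem

  infinite-class-splits : ∀ A → Inf (_∈ A) → Splittable A
  infinite-class-splits A inf with em {Σ Carrier λ a → IsSet a × (a ⊆ A × Inf (_∈ a))}
  ... | yes (a , a-set , a⊆A , a-inf) = Splittable-mono a⊆A (infinite-set-splits a a-set a-inf)
  -- `A` may be assumed unsplittable: each class then contains finitely many points of `A` or all
  -- but finitely many.
  ... | no no-infinite-set = dne λ unsplit → unsplit (split unsplit)
    where
    -- Every set meets `A` in a finite class, and finite classes are sets; so finiteness within `A`
    -- is expressible in the model as containment in a set.
    subset-finite : ∀ {P : Carrier → Set} y → IsSet y → (∀ w → w ∈ A × P w → w ∈ y) →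
      Finite (λ w → w ∈ A × P w)
    subset-finite {P} y y-set h = Fin-mono (λ w wp → ∈∩⁺ (h w wp) (proj₁ wp))
      (¬Inf⇒Fin λ i → no-infinite-set (y ∩ A , ⊆-set y-set (λ _ → proj₁ ∘ ∈∩⁻) , (λ _ → proj₂ ∘ ∈∩⁻) , i))

    -- Having finite out-degree, expressed inside M.
    LocallySmall : Carrier → Set
    LocallySmall a = Σ Carrier λ y → IsSet y × (∀ w → IsSet w → w ∈ A × Beats C a w → w ∈ y)

    small : Σ Carrier λ S → ∀ a → a ∈ S iff (IsSet a × LocallySmall a)
    small = comprehension 2 (ex (all ((rel v0 (suc (suc v1)) ∧f beatsF (suc (suc v2)) v2 v0) ⇒f rel v0 v1)))
              (A ◂ C ◂ ⟨⟩)

    S A₁ A₂ : Carrier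
    S  = proj₁ small
    A₁ = A ∩ S
    A₂ = A ∩ ∁ S

    A₁-finite-out : ∀ a → a ∈ A₁ → Finite (λ w → w ∈ A₁ × Beats C a w)
    A₁-finite-out a a∈ with proj₁ (proj₂ small a) (proj₂ (∈∩⁻ a∈))
    ... | _ , y , y-set , h = Fin-mono (λ w (w∈ , b) → proj₁ (∈∩⁻ w∈) , b)
            (subset-finite y y-set (λ w wp → h w (A , proj₁ wp) wp))

    -- As `a` is not in `S`, it beats infinitely many points of `A`, hence all but finitely many. By
    -- antisymmetry, a point that beats `a` is `a` itself or one of these exceptions.
    A₂-finite-in : ¬ Splittable A → ∀ a → a ∈ A₂ → Finite (λ w → w ∈ A₂ × flip (Beats C) a w)
    A₂-finite-in unsplit a a∈ = Fin-∪ cov (Fin-singleton a (λ _ → id)) co-finite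
      where
      a-set : IsSet a
      a-set = A₂ , a∈
      beaten : Σ Carrier λ L → ∀ w → w ∈ L iff (IsSet w × Beats C a w)
      beaten = comprehension 2 (beatsF v2 v1 v0) (a ◂ C ◂ ⟨⟩)
      L : Carrier
      L = proj₁ beaten
      L-infinite : Inf (λ w → w ∈ L × w ∈ A)
      L-infinite = dne λ ¬i → contradiction (not-small (¬Inf⇒Fin ¬i)) (∈∁⁻ (proj₂ (∈∩⁻ a∈)))
        where
        not-small : Finite (λ w → w ∈ L × w ∈ A) → a ∈ S
        not-small fin with set-of (λ w (w∈L , _) → L , w∈L) fin
        ... | y , y-set , y-mem = proj₂ (proj₂ small a) (a-set , y , y-set , λ w sw (w∈A , b) →
                proj₂ (y-mem w) (proj₂ (proj₂ beaten w) (sw , b) , w∈A))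
      co-finite : Finite (λ w → (¬ w ∈ L) × w ∈ A)
      co-finite = ¬Inf⇒Fin λ i → unsplit (L , L-infinite , i)
      cov : ∀ w → w ∈ A₂ × Beats C w a → w ≡ a ⊎ ((¬ w ∈ L) × w ∈ A)
      cov w (w∈ , b) with em {w ∈ L}
      ... | yes w∈L = inj₁ (Beats-antisym (A₂ , w∈) a-set b (proj₂ (proj₁ (proj₂ beaten w) w∈L)))
      ... | no w∉L  = inj₂ (w∉L , proj₁ (∈∩⁻ w∈))

    split : ¬ Splittable A → Splittable A
    split unsplit with em {Inf (_∈ A₁)}
    ... | yes A₁-inf = Splittable-mono (λ _ → proj₁ ∘ ∈∩⁻) (tournament-splits A₁ (Beats C) A₁-inf
            Beats-total Beats-antisym A₁-finite-out
            (comprehension 2 (alternateF (kingF beatsF)) (A₁ ◂ C ◂ ⟨⟩)))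
    -- Reversing the tournament turns finite in-degrees into finite out-degrees.
    ... | no ¬A₁-inf = Splittable-mono (λ _ → proj₁ ∘ ∈∩⁻) (tournament-splits A₂ (flip (Beats C)) A₂-inf
            (λ sa sb → Beats-total sb sa) (λ sa sb b b′ → Beats-antisym sa sb b′ b)
            (A₂-finite-in unsplit)
            (comprehension 2 (alternateF (kingF (λ C a b → beatsF C b a))) (A₂ ◂ C ◂ ⟨⟩)))
      where
      A₂-inf : Inf (_∈ A₂)
      A₂-inf = Inf-∖ cov inf (¬Inf⇒Fin ¬A₁-inf)
        where
        cov : ∀ w → w ∈ A → w ∈ A₁ ⊎ w ∈ A₂
        cov w w∈A with em {w ∈ S}
        ... | yes h = inj₁ (∈∩⁺ w∈A h)
        ... | no ¬h = inj₂ (∈∩⁺ w∈A (∈∁⁺ (A , w∈A) ¬h))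

  -- Cells and elementary equivalence

  -- The base case makes the cells a partition of the sets, which are the only possible elements.
  Cell : ∀ {n} → Vec Bool n → Vector Carrier n → Carrier → Set
  Cell []          a w = IsSet w
  Cell (true  ∷ s) a w = w ∈ a zero × Cell s (a ∘ suc) w
  Cell (false ∷ s) a w = (¬ w ∈ a zero) × Cell s (a ∘ suc) w

  Cell⇒set : ∀ {n} s {a : Vector Carrier n} {w} → Cell s a w → IsSet w
  Cell⇒set []          h       = h
  Cell⇒set (true  ∷ s) (_ , h) = Cell⇒set s h
  Cell⇒set (false ∷ s) (_ , h) = Cell⇒set s h

  cell-of : ∀ {n} (a : Vector Carrier n) {w} → IsSet w → Σ (Vec Bool n) λ s → Cell s a w
  cell-of {zero}  a sw = [] , sw
  cell-of {suc n} a {w} sw with em {w ∈ a zero} | cell-of (a ∘ suc) sw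
  ... | yes h | s , c = true  ∷ s , h , c
  ... | no ¬h | s , c = false ∷ s , ¬h , c

  Cell-agree : ∀ {n} s {a b : Vector Carrier n} {w v} → Cell s a w → Cell s b v →
    ∀ i → w ∈ a i → v ∈ b i
  Cell-agree (true  ∷ s) _       (h , _) zero    _   = h
  Cell-agree (false ∷ s) (h , _) _       zero    w∈a = contradiction w∈a h
  Cell-agree (true  ∷ s) (_ , c) (_ , d) (suc i) w∈a = Cell-agree s c d i w∈a
  Cell-agree (false ∷ s) (_ , c) (_ , d) (suc i) w∈a = Cell-agree s c d i w∈a

  cell-class : ∀ {n} s (a : Vector Carrier n) → Σ Carrier λ c → ∀ w → w ∈ c iff Cell s a w
  cell-class []          a = V , λ w → (V ,_) , ∈V
  cell-class (true  ∷ s) a with cell-class s (a ∘ suc)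
  ... | c , mem = a zero ∩ c , λ w →
    map₂ (proj₁ (mem w)) ∘ ∈∩⁻ , (λ (h , h′) → ∈∩⁺ h (proj₂ (mem w) h′))
  cell-class (false ∷ s) a with cell-class s (a ∘ suc)
  ... | c , mem = ∁ (a zero) ∩ c , λ w →
    (λ h → ∈∁⁻ (proj₁ (∈∩⁻ h)) , proj₁ (mem w) (proj₂ (∈∩⁻ h))) ,
    (λ (h , h′) → ∈∩⁺ (∈∁⁺ (Cell⇒set s h′) h) (proj₂ (mem w) h′))

  -- `f` lives in the metatheory, but the cells are finitely many: cut along the first parameter and
  -- join the two halves.
  glue : ∀ {n} (a : Vector Carrier n) (f : Vec Bool n → Carrier) →
    Σ Carrier λ y → ∀ s w → Cell s a w → w ∈ y iff w ∈ f s
  glue {zero}  a f = f [] , λ { [] w _ → id , id }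
  glue {suc n} a f with glue (a ∘ suc) (f ∘ (true ∷_)) | glue (a ∘ suc) (f ∘ (false ∷_))
  ... | y , yh | z , zh = (a zero ∩ y) ∪ (∁ (a zero) ∩ z) , mem
    where
    mem : ∀ s w → Cell s a w → w ∈ ((a zero ∩ y) ∪ (∁ (a zero) ∩ z)) iff w ∈ f s
    mem (true ∷ s) w (h , c) =
      (λ w∈ → [ proj₁ (yh s w c) ∘ proj₂ ∘ ∈∩⁻ , (λ k → contradiction h (∈∁⁻ (proj₁ (∈∩⁻ k)))) ]′ (∈∪⁻ w∈)) ,
      (λ k → ∈∪⁺ (inj₁ (∈∩⁺ h (proj₂ (yh s w c) k))))
    mem (false ∷ s) w (h , c) =
      (λ w∈ → [ (λ k → contradiction (proj₁ (∈∩⁻ k)) h) , proj₁ (zh s w c) ∘ proj₂ ∘ ∈∩⁻ ]′ (∈∪⁻ w∈)) ,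
      (λ k → ∈∪⁺ (inj₂ (∈∩⁺ (∈∁⁺ (Cell⇒set s c) h) (proj₂ (zh s w c) k))))

  exact-subclass : ∀ j {P : Carrier → Set} → (∀ w → P w → IsSet w) → AtLeast j P →
    Σ Carrier λ y → (∀ w → w ∈ y → P w) × Exact j (_∈ y)
  exact-subclass zero    sets _ = ∅ , (λ _ → ⊥-elim ∘ ∉∅) , tt , (λ (_ , h , _) → ∉∅ h)
  exact-subclass (suc j) {P} sets (u , pu , ps) with exact-subclass j (λ w → sets w ∘ proj₁) ps
  ... | y , y⊆ , ex-y = y ∪ ❴ u ❵ ,
    (λ w w∈ → [ proj₁ ∘ y⊆ w , (λ h → subst P (sym (∈❴❵⁻ h)) pu) ]′ (∈∪⁻ w∈)) ,
    Exact-insert (λ _ → ∈∪⁺ ∘ inj₁) (λ _ → Sum.map₂ ∈❴❵⁻ ∘ ∈∪⁻)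
      (∈∪⁺ (inj₂ (∈❴❵⁺ (sets u pu)))) (λ u∈y → proj₂ (y⊆ u u∈y) refl) ex-y

  Part CoPart : Carrier → (Carrier → Set) → Carrier → Set
  Part   x R w = w ∈ x × R w
  CoPart x R w = (¬ w ∈ x) × R w

  -- One move of the game within one cell. If a part has fewer than `N` points, its exact size is
  -- copied and the other part follows by subtraction.
  match-part : ∀ {N} {R R′ : Carrier → Set} x → (∀ w → R′ w → IsSet w) → R ≈[ N + N ] R′ →
    Σ Carrier λ y → (Part x R ≈[ N ] Part y R′) × (CoPart x R ≈[ N ] CoPart y R′)
  match-part {N} {R} {R′} x sets e
    with size N (Part x R) | size N (CoPart x R)
  ... | inj₂ (j , j<N , ex-j) | _ =
    y , Exact⇒≈ ex-j ex-y , complement-≈ (Splits-∈ R (_∈ x)) (Splits-∈ R′ (_∈ y)) e j<N ex-j ex-y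
    where
    sub = exact-subclass j sets
      (proj₁ (e j (≤-trans (<⇒≤ j<N) (m≤m+n N N))) (AtLeast-mono j (λ _ → proj₂) (proj₁ ex-j)))
    y : Carrier
    y = proj₁ sub
    ex-y : Exact j (Part y R′)
    ex-y = Exact-cong (λ w h → h , proj₁ (proj₂ sub) w h) (λ _ → proj₁) (proj₂ (proj₂ sub))
  ... | inj₁ _ | inj₂ (j , j<N , ex-j) =
    ∁ y , complement-≈ (Splits-sym (Splits-∈ R (_∈ x))) (Splits-sym (Splits-∈ R′ (_∈ ∁ y))) e j<N ex-j ex-y ,
    Exact⇒≈ ex-j ex-y
    where
    sub = exact-subclass j sets
      (proj₁ (e j (≤-trans (<⇒≤ j<N) (m≤m+n N N))) (AtLeast-mono j (λ _ → proj₂) (proj₁ ex-j)))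
    y : Carrier
    y = proj₁ sub
    ex-y : Exact j (CoPart (∁ y) R′)
    ex-y = Exact-cong (λ w h → (λ h′ → ∈∁⁻ h′ h) , proj₁ (proj₂ sub) w h)
             (λ w (h , r) → dne λ w∉y → h (∈∁⁺ (sets w r) w∉y)) (proj₂ (proj₂ sub))
  -- Both parts are large, so `R′` has `N + N` points: `N` of them go into `y`, and at least `N`
  -- remain.
  ... | inj₁ p | inj₁ q = y , AtLeast⇒≈ p p′ , AtLeast⇒≈ q q′
    where
    R′-large : AtLeast (N + N) R′
    R′-large = proj₁ (e (N + N) ≤-refl) (AtLeast-+ N N (λ _ → proj₂) (λ _ → proj₂)
      (λ _ (h , _) (¬h , _) → ¬h h) p q)
    sub = exact-subclass N sets (AtLeast-down (m≤m+n N N) R′-large)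
    y : Carrier
    y = proj₁ sub
    ex-y : Exact N (Part y R′)
    ex-y = Exact-cong (λ w h → h , proj₁ (proj₂ sub) w h) (λ _ → proj₁) (proj₂ (proj₂ sub))
    p′ : AtLeast N (Part y R′)
    p′ = proj₁ ex-y
    q′ : AtLeast N (CoPart y R′)
    q′ = [ ⊥-elim ∘ proj₂ ex-y , id ]′
           (AtLeast-pigeonhole N N (Splits.cover (Splits-∈ R′ (_∈ y))) R′-large)

  infix 4 _≋[_]_
  _≋[_]_ : ∀ {n} → Vector Carrier n → ℕ → Vector Carrier n → Set
  a ≋[ N ] b = ∀ s → Cell s a ≈[ N ] Cell s b

  ≋-sym : ∀ {n N} {a b : Vector Carrier n} → a ≋[ N ] b → b ≋[ N ] a
  ≋-sym e s = ≈-sym (e s)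

  ≋-down : ∀ {n N N′} {a b : Vector Carrier n} → N ≤ N′ → a ≋[ N′ ] b → a ≋[ N ] b
  ≋-down N≤ e s k k≤ = e s k (≤-trans k≤ N≤)

  -- The cells are independent: answer `x` in each one by `match-part` and glue the answers.
  ≋-extend : ∀ {n N} {a b : Vector Carrier n} → a ≋[ N + N ] b → ∀ x →
    Σ Carrier λ y → (x ◂ a) ≋[ N ] (y ◂ b)
  ≋-extend {n} {N} {a} {b} e x = y , matches
    where
    parts : ∀ s → Σ Carrier λ y →
      (Part x (Cell s a) ≈[ N ] Part y (Cell s b)) × (CoPart x (Cell s a) ≈[ N ] CoPart y (Cell s b))
    parts s = match-part x (λ _ → Cell⇒set s) (e s)
    glued = glue b (proj₁ ∘ parts)
    y : Carrier
    y = proj₁ glued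
    matches : (x ◂ a) ≋[ N ] (y ◂ b)
    matches (true ∷ s) k k≤ =
      AtLeast-mono k (λ w (h , c) → proj₂ (proj₂ glued s w c) h , c) ∘ proj₁ (proj₁ (proj₂ (parts s)) k k≤) ,
      proj₂ (proj₁ (proj₂ (parts s)) k k≤) ∘ AtLeast-mono k (λ w (h , c) → proj₁ (proj₂ glued s w c) h , c)
    matches (false ∷ s) k k≤ =
      AtLeast-mono k (λ w (h , c) → h ∘ proj₁ (proj₂ glued s w c) , c) ∘ proj₁ (proj₂ (proj₂ (parts s)) k k≤) ,
      proj₂ (proj₂ (proj₂ (parts s)) k k≤) ∘ AtLeast-mono k (λ w (h , c) → h ∘ proj₂ (proj₂ glued s w c) , c)

  -- Inclusion only depends on which cells are nonempty, so threshold 1 suffices.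
  ⊆-≋ : ∀ {n} {a b : Vector Carrier n} → a ≋[ 1 ] b → ∀ i j → a i ⊆ a j → b i ⊆ b j
  ⊆-≋ {a = a} {b} e i j sub c c∈ with cell-of b (b i , c∈)
  ... | s , cell with proj₂ (e s 1 ≤-refl) (c , cell , tt)
  ...   | w , cell′ , _ = Cell-agree s cell′ cell j (sub w (Cell-agree s cell cell′ i c∈))

  threshold : ∀ {n} → Formula n → ℕ
  threshold (rel i j) = 1
  threshold (eq i j)  = 1
  threshold fls       = 0
  threshold (φ ∧f ψ)  = threshold φ ⊔ threshold ψ
  threshold (φ ∨f ψ)  = threshold φ ⊔ threshold ψ
  threshold (φ ⇒f ψ)  = threshold φ ⊔ threshold ψ
  threshold (all φ)   = threshold φ + threshold φ
  threshold (ex φ)    = threshold φ + threshold φ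

  Sat-≋ : ∀ {n} (φ : Formula n) {a b : Vector Carrier n} → a ≋[ threshold φ ] b →
    Sat _⊆_ a φ → Sat _⊆_ b φ
  Sat-≋ (rel i j) e h = ⊆-≋ e i j h
  Sat-≋ (eq i j) e h =
    ext (⊆-≋ e i j (λ c → subst (c ∈_) h)) (⊆-≋ e j i (λ c → subst (c ∈_) (sym h)))
  Sat-≋ (φ ∧f ψ) e (h , h′) =
    Sat-≋ φ (≋-down (m≤m⊔n _ _) e) h , Sat-≋ ψ (≋-down (m≤n⊔m _ _) e) h′
  Sat-≋ (φ ∨f ψ) e =
    Sum.map (Sat-≋ φ (≋-down (m≤m⊔n _ _) e)) (Sat-≋ ψ (≋-down (m≤n⊔m _ _) e))
  Sat-≋ (φ ⇒f ψ) e h =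
    Sat-≋ ψ (≋-down (m≤n⊔m _ _) e) ∘ h ∘ Sat-≋ φ (≋-down (m≤m⊔n _ _) (≋-sym e))
  Sat-≋ (all φ) e h y with ≋-extend (≋-sym e) y
  ... | x , e′ = Sat-≋ φ (≋-sym e′) (h x)
  Sat-≋ (ex φ) e (x , h) with ≋-extend e x
  ... | y , e′ = y , Sat-≋ φ e′ h

  -- Saturation

  -- The size of a cell as saturation sees it: `just j` is exactly j, `nothing` is infinite.
  Size : Set
  Size = Maybe ℕ

  -- Infinity is approximated: precision `N` asks for `N` points, and all `N` together ask for
  -- infinitely many.
  Match : Size → ℕ → (Carrier → Set) → Set
  Match (just j) N P = Exact j P
  Match nothing  N P = AtLeast N P

  Match-down : ∀ {P N N′} τ → N ≤ N′ → Match τ N′ P → Match τ N P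
  Match-down (just j) N≤ h = h
  Match-down nothing  N≤ h = AtLeast-down N≤ h

  Match⇒≈ : ∀ {P Q N} τ → Match τ N P → Match τ N Q → P ≈[ N ] Q
  Match⇒≈ (just j) = Exact⇒≈
  Match⇒≈ nothing  = AtLeast⇒≈

  Match-cong : ∀ {P Q N} τ → (∀ w → P w → Q w) → (∀ w → Q w → P w) → Match τ N P → Match τ N Q
  Match-cong         (just j) f g = Exact-cong f g
  Match-cong {N = N} nothing  f g = AtLeast-mono N f

  -- When one size is finite, the approximation at 0 already works: its other part is as large as
  -- that of any later approximation, by subtraction. When both are infinite, `A` has to be cut.
  realize-part : ∀ τ₁ τ₂ {R} (A : Carrier) → (∀ w → w ∈ A iff R w) →
    (∀ N → Σ Carrier λ m → Match τ₁ N (Part m R) × Match τ₂ N (CoPart m R)) →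
    Σ Carrier λ y → ∀ N → Match τ₁ N (Part y R) × Match τ₂ N (CoPart y R)
  realize-part (just j) (just k) A A-mem approx = proj₁ (approx 0) , λ N → proj₂ (approx 0)
  realize-part (just j) nothing {R} A A-mem approx = y , λ N →
    proj₁ (proj₂ (approx 0)) ,
    complement-AtLeast N (Splits-∈ R (_∈ proj₁ (approx N))) (Splits-∈ R (_∈ y))
      (proj₁ (proj₂ (approx N))) (proj₁ (proj₂ (approx 0))) id (proj₂ (proj₂ (approx N)))
    where
    y : Carrier
    y = proj₁ (approx 0)
  realize-part nothing (just k) {R} A A-mem approx = y , λ N →
    complement-AtLeast N (Splits-sym (Splits-∈ R (_∈ proj₁ (approx N)))) (Splits-sym (Splits-∈ R (_∈ y)))
      (proj₂ (proj₂ (approx N))) (proj₂ (proj₂ (approx 0))) id (proj₁ (proj₂ (approx N))) ,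
    proj₂ (proj₂ (approx 0))
    where
    y : Carrier
    y = proj₁ (approx 0)
  realize-part nothing nothing A A-mem approx
    with infinite-class-splits A
           (λ N → AtLeast-mono N (λ w (_ , r) → proj₂ (A-mem w) r) (proj₁ (proj₂ (approx N))))
  ... | B , inside , outside = B , λ N →
    AtLeast-mono N (λ w → map₂ (proj₁ (A-mem w))) (inside N) ,
    AtLeast-mono N (λ w → map₂ (proj₁ (A-mem w))) (outside N)

  module _ {n : ℕ} (a : Vector Carrier n) (p : Formula (suc n) → Set) where

    -- `D` collects the sizes fixed so far, at precision `N`. They extend the type without being
    -- written as formulas.
    Consistent : (ℕ → Carrier → Set) → Set
    Consistent D = ∀ l → All p l → ∀ N →
      Σ Carrier λ m → All (Sat _⊆_ (m ◂ a)) l × D N m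

    Antitone : (ℕ → Carrier → Set) → Set
    Antitone D = ∀ {N N′ m} → N ≤ N′ → D N′ m → D N m

    Refuted : (ℕ → Carrier → Set) → (Carrier → Set) → Set
    Refuted D X = Σ (List (Formula (suc n))) λ l → All p l × Σ ℕ λ N →
      ∀ m → All (Sat _⊆_ (m ◂ a)) l → D N m → ¬ X m

    inconsistent⇒refuted : ∀ {D X} → ¬ Consistent (λ N m → D N m × X m) → Refuted D X
    inconsistent⇒refuted {D} {X} h with ¬∀⇒∃¬ h
    ... | l , h′ with em {All p l}
    ...   | no ¬pl = contradiction (λ pl → contradiction pl ¬pl) h′
    ...   | yes pl with em {Σ ℕ λ N → ∀ m → All (Sat _⊆_ (m ◂ a)) l → D N m → ¬ X m}
    ...     | yes (N , r) = l , pl , N , r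
    ...     | no ¬r = contradiction
      (λ _ N → dne λ none → ¬r (N , λ m sat d x → none (m , sat , d , x))) h′

    -- If every exact size is refuted, then so is every finite set of sizes, and `nothing` is consistent.
    add-size : ∀ {D} → Antitone D → Consistent D → (Q : Carrier → Carrier → Set) →
      Σ Size λ τ → Consistent (λ N m → D N m × Match τ N (Q m))
    add-size {D} anti cons Q with em {Σ ℕ λ j → Consistent (λ N m → D N m × Exact j (Q m))}
    ... | yes (j , c) = just j , c
    ... | no ¬c = nothing , large
      where
      refute : ∀ K → Refuted D (λ m → Σ ℕ λ j → j < K × Exact j (Q m))
      refute zero = [] , [] , 0 , λ { m _ _ (_ , () , _) }
      refute (suc K) with refute K | inconsistent⇒refuted {D} (λ c → ¬c (K , c))
      ... | l , pl , N , r | l′ , pl′ , N′ , r′ =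
        l ++ l′ , ++⁺ pl pl′ , N ⊔ N′ , λ m sat d (j , j≤K , e) →
          [ (λ { (s≤s j<K) → r m (++⁻ˡ l sat) (anti (m≤m⊔n N N′) d) (j , j<K , e) })
          , (λ { refl → r′ m (++⁻ʳ l sat) (anti (m≤n⊔m N N′) d) e })
          ]′ (m≤n⇒m<n∨m≡n j≤K)
      large : Consistent (λ N m → D N m × AtLeast N (Q m))
      large l pl N with refute N
      ... | l′ , pl′ , N′ , r with cons (l ++ l′) (++⁺ pl pl′) (N ⊔ N′)
      ...   | m , sat , d = m , ++⁻ˡ l sat , anti (m≤m⊔n N N′) d ,
        [ id , ⊥-elim ∘ r m (++⁻ʳ l sat) (anti (m≤n⊔m N N′) d) ]′ (size N (Q m))

    -- Sizes are fixed one cell at a time, and those already fixed are carried along in `D`, so that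
    -- all remain jointly consistent with the type.
    add-sizes : ∀ k {D} → Antitone D → Consistent D → (Q : Vec Bool k → Carrier → Carrier → Set) →
      Σ (Vec Bool k → Size) λ τ → Consistent (λ N m → D N m × (∀ s → Match (τ s) N (Q s m)))
    add-sizes zero anti cons Q with add-size anti cons (Q [])
    ... | τ , c = (λ _ → τ) , λ l pl N → map₂ (map₂ (map₂ λ { h [] → h })) (c l pl N)
    add-sizes (suc k) {D} anti cons Q with add-sizes k anti cons (Q ∘ (true ∷_))
    ... | τ , c with add-sizes k {λ N m → D N m × (∀ s → Match (τ s) N (Q (true ∷ s) m))}
                       (λ N≤ (d , h) → anti N≤ d , λ s → Match-down (τ s) N≤ (h s)) c (Q ∘ (false ∷_))
    ...   | τ′ , c′ = τ″ , combine
      where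
      τ″ : Vec Bool (suc k) → Size
      τ″ (true  ∷ s) = τ s
      τ″ (false ∷ s) = τ′ s
      combine : Consistent (λ N m → D N m × (∀ s → Match (τ″ s) N (Q s m)))
      combine l pl N with c′ l pl N
      ... | m , sat , (d , h) , h′ = m , sat , d , λ { (true ∷ s) → h s ; (false ∷ s) → h′ s }

    realize : Consistent (λ _ _ → ⊤) → Realized _⊆_ a p
    realize cons with add-sizes (suc n) (λ _ _ → tt) cons (λ s m → Cell s (m ◂ a))
    ... | τ , c = y , sat
      where
      parts : ∀ s → Σ Carrier λ y → ∀ N →
        Match (τ (true ∷ s)) N (Part y (Cell s a)) × Match (τ (false ∷ s)) N (CoPart y (Cell s a))
      -- The empty part of the type suffices here, as only the sizes matter.
      parts s = realize-part (τ (true ∷ s)) (τ (false ∷ s)) (proj₁ (cell-class s a)) (proj₂ (cell-class s a)) λ N →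
        proj₁ (c [] [] N) , proj₂ (proj₂ (proj₂ (c [] [] N))) (true ∷ s) ,
        proj₂ (proj₂ (proj₂ (c [] [] N))) (false ∷ s)
      glued = glue a (proj₁ ∘ parts)
      y : Carrier
      y = proj₁ glued
      y-match : ∀ s N → Match (τ s) N (Cell s (y ◂ a))
      y-match (true ∷ s) N = Match-cong (τ (true ∷ s))
        (λ w (h , d) → proj₂ (proj₂ glued s w d) h , d)
        (λ w (h , d) → proj₁ (proj₂ glued s w d) h , d) (proj₁ (proj₂ (parts s) N))
      y-match (false ∷ s) N = Match-cong (τ (false ∷ s))
        (λ w (h , d) → h ∘ proj₁ (proj₂ glued s w d) , d)
        (λ w (h , d) → h ∘ proj₂ (proj₂ glued s w d) , d) (proj₂ (proj₂ (parts s) N))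
      sat : ∀ φ → p φ → Sat _⊆_ (y ◂ a) φ
      -- `m` satisfies `φ` and has the prescribed sizes up to the threshold of `φ`, at which `φ`
      -- cannot tell `y` from `m`.
      sat φ pφ with c (φ ∷ []) (pφ ∷ []) (threshold φ)
      ... | m , (satφ ∷ []) , _ , h =
        Sat-≋ φ (λ s → Match⇒≈ (τ s) (h s) (y-match s (threshold φ))) satφ

  saturated : ωSaturated _⊆_
  saturated n a p fin-sat = realize a p λ l pl _ → map₂ (_, tt) (fin-sat l pl)

theorem17 : ExcludedMiddle 0ℓ → (M : ∈-Structure) → GBC.IsModel M →
    IsAtomicBooleanAlgebra (GBC._⊆_ M) × Infinite (∈-Structure.Carrier M) × ωSaturated (GBC._⊆_ M)
theorem17 em M isModel = atomicBooleanAlgebra , infinite , saturated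
  where open Model em M isModel
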